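{- There exist $M\in\mathbb{N}$ and a nonempty set $A\subset\mathbb{Z}_M$ such that $A$ satisfies both (T1) and (T2), $M$ has four distinct prime divisors, and $A(X)$ has at least one unsupported cyclotomic divisor.
   Context: $\mathbb{Z}_M=\mathbb{Z}/M\mathbb{Z}$. For $A\subset\mathbb{Z}_M$, represent its elements by integers in $\{0,1,\dots,M-1\}$; the mask polynomial is $A(X)=\sum_{a\in A}X^a$, considered modulo $X^M-1$. For $s\mid M$, divisibility of $A(X)$ by the $s$-th cyclotomic polynomial $\Phi_s(X)$ is well defined, since $\Phi_s\mid X^M-1$; all cyclotomic divisors $\Phi_s$ considered have $s\mid M$. "$M$ has four distinct prime divisors" means exactly four. $S_A^*$ is the set of all prime powers $p^\alpha>1$ (with $p^\alpha\mid M$) such that $\Phi_{p^\alpha}(X)\mid A(X)$. Conditions: (T1) $|A|=\prod_{s\in S_A^*}\Phi_s(1)$; (T2) if $s_1,\dots,s_k\in S_A^*$ are powers of distinct primes, then $\Phi_{s_1\cdots s_k}(X)$ divides $A(X)$. If $s\neq1$ and $\Phi_s\mid A$, then $\Phi_s$ is called an unsupported divisor of $A$ if (i) for every prime $p\mid s$ we have $p\mid |A|$, and (ii) for every prime power $p^\alpha$ with $p^\alpha\parallel s$ (i.e. $p$ is a prime dividing $s$, $p^\alpha\mid s$ and $p^{\alpha+1}\nmid s$), we have $\Phi_{p^\alpha}\nmid A$. -}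

module Defs where

open import Algebra.Bundles.Raw using (RawMagma)
open import Algebra.Definitions.RawMagma using () renaming (_∣_ to Divides)
open import Data.Bool.Base using (if_then_else_)
open import Data.Fin.Subset using (Subset; ∣_∣)
open import Data.Integer.Base as ℤ using (ℤ; +_; -1ℤ; 0ℤ; 1ℤ)
open import Data.List.Base
  using (List; []; _∷_; _++_; drop; filter; foldr; length; map; replicate; reverse; upTo)
open import Data.List.Membership.Propositional using (_∈_)
open import Data.List.Relation.Unary.All using (All)
open import Data.List.Relation.Unary.Unique.Propositional using (Unique)
open import Data.Nat.Base using (ℕ; zero; suc; _^_; _∸_; _≤_)
open import Data.Nat.Divisibility using (_∣_; _∣?_)
open import Data.Nat.ListAction using (product)
open import Data.Nat.Primality using (Prime)
open import Data.Product.Base using (_×_; _,_; Σ-syntax; ∃-syntax; proj₁; uncurry)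
import Data.Vec.Base as Vec
open import Function.Bundles using (_⇔_)
open import Level using (0ℓ)
open import Relation.Binary.PropositionalEquality using (_≡_; _≢_; refl)
open import Relation.Nullary.Negation.Core using (¬_)

-- ℤ[X]: coefficient lists, constant term first.  Trailing zeros are allowed,
-- so the equality of polynomials is _≈ₚ_, not _≡_.

Poly : Set
Poly = List ℤ

coeff : Poly → ℕ → ℤ
coeff []      _       = 0ℤ
coeff (a ∷ P) zero    = a
coeff (a ∷ P) (suc i) = coeff P i

infix  4 _≈ₚ_ _∣ₚ_
infixl 6 _+ₚ_ _-ₚ_
infixl 7 _*ₚ_ _·ₚ_ _/ₚ_

_≈ₚ_ : Poly → Poly → Set
P ≈ₚ Q = ∀ i → coeff P i ≡ coeff Q i

_+ₚ_ : Poly → Poly → Poly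
[]      +ₚ Q       = Q
(a ∷ P) +ₚ []      = a ∷ P
(a ∷ P) +ₚ (b ∷ Q) = (a ℤ.+ b) ∷ (P +ₚ Q)

_·ₚ_ : ℤ → Poly → Poly
c ·ₚ P = map (c ℤ.*_) P

_-ₚ_ : Poly → Poly → Poly
P -ₚ Q = P +ₚ (-1ℤ ·ₚ Q)

_*ₚ_ : Poly → Poly → Poly
[]      *ₚ Q = []
(a ∷ P) *ₚ Q = (a ·ₚ Q) +ₚ (0ℤ ∷ (P *ₚ Q))

productₚ : List Poly → Poly
productₚ = foldr _*ₚ_ (1ℤ ∷ [])

eval : Poly → ℤ → ℤ
eval P x = foldr (λ a v → a ℤ.+ x ℤ.* v) 0ℤ P

*ₚ-rawMagma : RawMagma 0ℓ 0ℓ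
*ₚ-rawMagma = record { Carrier = Poly ; _≈_ = _≈ₚ_ ; _∙_ = _*ₚ_ }

_∣ₚ_ : Poly → Poly → Set
_∣ₚ_ = Divides *ₚ-rawMagma

-- Long division by a monic D.  longDiv takes lists with the leading coefficient
-- first, and D without its leading 1: each step emits the leading coefficient a of
-- the dividend and cancels it by subtracting a times the shifted D.  The first
-- argument is the number of coefficients of the quotient.

longDiv : ℕ → List ℤ → List ℤ → List ℤ
longDiv zero    P       D = []
longDiv (suc k) []      D = []
longDiv (suc k) (a ∷ P) D = a ∷ longDiv k (P -ₚ (a ·ₚ D)) D

_/ₚ_ : Poly → Poly → Poly
P /ₚ D = reverse (longDiv (suc (length P) ∸ length D) (reverse P) (drop 1 (reverse D)))

X^_-𝟙 : ℕ → Poly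
X^ n -𝟙 = (replicate n 0ℤ ++ 1ℤ ∷ []) -ₚ (1ℤ ∷ [])

-- Cyclotomic polynomials, from X^n - 1 = ∏_{d ∣ n} Φ_d(X):
-- Φ_n is X^n - 1 divided by the product of Φ_d over the proper divisors d of n.
-- The first argument of Φ-rec bounds the recursion depth; n always suffices,
-- since each recursive call is at some d < n.  Φ 0 is a junk value.

properDivisors : ℕ → List ℕ
properDivisors n = filter (_∣? n) (upTo n)

Φ-rec : ℕ → ℕ → Poly
Φ-rec zero       n = []
Φ-rec (suc fuel) n = (X^ n -𝟙) /ₚ productₚ (map (Φ-rec fuel) (properDivisors n))

Φ : ℕ → Poly
Φ n = Φ-rec n n

_ : Φ 1 ≡ -1ℤ ∷ 1ℤ ∷ []
_ = refl

_ : Φ 12 ≡ 1ℤ ∷ 0ℤ ∷ -1ℤ ∷ 0ℤ ∷ 1ℤ ∷ []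
_ = refl

-- A subset of ℤ_M is a subset of the residues 0, …, M - 1, stored as its vector of
-- membership bits; read as 0/1 coefficients, that vector is the mask polynomial.

mask : ∀ {M} → Subset M → Poly
mask A = Vec.toList (Vec.map (λ b → if b then 1ℤ else 0ℤ) A)

IsPrimePower : ℕ → Set
IsPrimePower s = ∃[ p ] ∃[ α ] Prime p × 1 ≤ α × s ≡ p ^ α

-- s ∈S* A means s ∈ S_A^*.

infix 4 _∈S*_

_∈S*_ : ∀ {M} → ℕ → Subset M → Set
_∈S*_ {M} s A = IsPrimePower s × s ∣ M × Φ s ∣ₚ mask A

-- The product over the finite set S_A^* is taken along a repetition-free
-- enumeration S of that set.

T1 : ∀ {M} → Subset M → Set
T1 A = Σ[ S ∈ List ℕ ]
  Unique S ×
  (∀ s → s ∈ S ⇔ s ∈S* A) ×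
  + ∣ A ∣ ≡ foldr ℤ._*_ 1ℤ (map (λ s → eval (Φ s) 1ℤ) S)

-- s₁, …, s_k is given by the list of pairs (p , α) with sᵢ = p ^ α.  The list must be
-- nonempty: the empty product would demand Φ₁ ∣ A, i.e. A = ∅.

T2 : ∀ {M} → Subset M → Set
T2 A = (pαs : List (ℕ × ℕ)) → pαs ≢ [] →
  All (λ (p , α) → Prime p × p ^ α ∈S* A) pαs →
  Unique (map proj₁ pαs) →
  Φ (product (map (uncurry _^_) pαs)) ∣ₚ mask A

record Unsupported {M} (A : Subset M) (s : ℕ) : Set where
  field
    s∣M        : s ∣ M
    s≢1        : s ≢ 1
    divisor    : Φ s ∣ₚ mask A
    primes     : ∀ p → Prime p → p ∣ s → p ∣ ∣ A ∣
    noPrimePow : ∀ p α → Prime p → p ∣ s → p ^ α ∣ s → ¬ (p ^ suc α ∣ s) →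
                 ¬ (Φ (p ^ α) ∣ₚ mask A)

HasDistinctPrimeDivisors : ℕ → ℕ → Set
HasDistinctPrimeDivisors k M = Σ[ ps ∈ List ℕ ]
  length ps ≡ k ×
  Unique ps ×
  (∀ p → p ∈ ps ⇔ (Prime p × p ∣ M))

{-# OPTIONS --safe #-}

-- The witness is
--   A(X) = (1 + X + … + X⁵) (1 + X¹² + X¹⁸ + X²⁴ + X³⁶)
--        = (X⁶ - 1)/(X - 1) · Φ₅(X⁶) · Φ₆(X⁶)
--        = Φ₂ Φ₃ Φ₆ · Φ₅ Φ₁₀ Φ₁₅ Φ₃₀ · Φ₃₆
-- inside ℤ_M for M = 1260 = 2² · 3² · 5 · 7.  It has 30 elements and
-- S_A^* = {2, 3, 5}, while Φ₃₆ is an unsupported divisor, since Φ₄ and Φ₉ do not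
-- divide A(X).  In other words, A is a complete residue system modulo 30 that meets
-- each class modulo 6 in five points, which modulo 36 split into a fiber of length 2
-- and a fiber of length 3; the mask polynomials of such fibers are divisible by Φ₃₆.
-- The prime 7 only serves to give M a fourth prime divisor.
module Submission where

open import Defs
open import Algebra.Definitions.RawMagma using (_,_)
open import Data.Fin.Base using (zero)
open import Data.Fin.Subset using (Subset; Nonempty; ∣_∣; inside; outside)
open import Data.Integer.Base as ℤ using (ℤ; +_; 0ℤ; 1ℤ)
import Data.Integer.Divisibility as ℤ∣
import Data.Integer.Properties as ℤ
open import Data.Integer.Tactic.RingSolver using (solve-∀)
open import Data.List.Base using (List; []; _∷_; map)
open import Data.List.Membership.Propositional using (_∈_)
open import Data.List.Properties using (map-cong-local)
open import Data.List.Relation.Unary.All as All using (All; []; _∷_)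
import Data.List.Relation.Unary.All.Properties as All
open import Data.List.Relation.Unary.AllPairs using ([]; _∷_)
open import Data.List.Relation.Unary.Any using (here; there)
open import Data.List.Relation.Unary.Unique.Propositional using (Unique)
open import Data.Nat.Base using (ℕ; zero; suc; _*_; _∸_; _^_; _≤_; _<_; s≤s; s≤s⁻¹; z≤n)
open import Data.Nat.Divisibility
  using (_∣_; _∣?_; divides; ∣-trans; ∣⇒≤; m∣m*n; 1∣_; *-monoʳ-∣)
open import Data.Nat.ListAction using (product)
open import Data.Nat.Primality
  using (Prime; prime?; euclidsLemma; prime⇒irreducible; ¬prime[1])
open import Data.Nat.Primality.Factorisation using (factorisationHasAllPrimeFactors)
open import Data.Nat.Properties
  using (_≟_; ≮⇒≥; *-comm; *-identityʳ; ^-distribˡ-+-*; m+[n∸m]≡n; m*n≡1⇒m≡1; allUpTo?)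
open import Data.List.Membership.DecPropositional _≟_ using (_∈?_)
open import Data.List.Relation.Unary.Unique.DecPropositional _≟_ using (unique?)
open import Data.Product.Base using (Σ-syntax; _×_; _,_; proj₁; proj₂; uncurry)
open import Data.Sum.Base using (inj₁; inj₂)
open import Data.Vec.Base as Vec using ([]; _∷_; _++_)
open import Function.Base using (_∘_)
open import Function.Bundles using (mk⇔)
open import Relation.Binary.PropositionalEquality
  using (_≡_; _≢_; refl; sym; trans; cong; cong₂; subst; module ≡-Reasoning)
open import Relation.Nullary.Decidable using
  (Dec; yes; no; True; map′; _×-dec_; _→-dec_; ¬?; toWitness; toWitnessFalse; from-yes; from-no)
open import Relation.Nullary.Negation.Core using (¬_; contradiction)

-- Deciding equality and exact division of polynomials.

≈[]? : ∀ P → Dec (P ≈ₚ [])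
≈[]? []      = yes λ _ → refl
≈[]? (a ∷ P) = map′ (λ { (a≡0 , P≈0) zero → a≡0 ; (a≡0 , P≈0) (suc i) → P≈0 i })
                    (λ eq → eq 0 , eq ∘ suc)
                    (a ℤ.≟ 0ℤ ×-dec ≈[]? P)

infix 4 _≈ₚ?_

-- Beyond the end of both lists every coefficient is 0, so finitely many comparisons settle an
-- equality over all indices; `≈[]?` handles trailing zeros.
_≈ₚ?_ : ∀ P Q → Dec (P ≈ₚ Q)
P       ≈ₚ? []      = ≈[]? P
[]      ≈ₚ? (b ∷ Q) = map′ (λ eq → sym ∘ eq) (λ eq → sym ∘ eq) (≈[]? (b ∷ Q))
(a ∷ P) ≈ₚ? (b ∷ Q) = map′ (λ { (a≡b , P≈Q) zero → a≡b ; (a≡b , P≈Q) (suc i) → P≈Q i })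
                           (λ eq → eq 0 , eq ∘ suc)
                           (a ℤ.≟ b ×-dec (P ≈ₚ? Q))

-- The result of `_/ₚ_` is only a candidate quotient: multiplying back certifies it, and for
-- concrete polynomials that check is a computation.
exactDivision : ∀ D P → True ((P /ₚ D) *ₚ D ≈ₚ? P) → D ∣ₚ P
exactDivision D P eq = P /ₚ D , toWitness eq

-- Evaluation at an integer.

module _ (x : ℤ) where

  open ≡-Reasoning

  eval-≈[] : ∀ P → P ≈ₚ [] → eval P x ≡ 0ℤ
  eval-≈[] []      _  = refl
  eval-≈[] (a ∷ P) eq = begin
    a ℤ.+ x ℤ.* eval P x ≡⟨ cong₂ (λ a v → a ℤ.+ x ℤ.* v) (eq 0) (eval-≈[] P (eq ∘ suc)) ⟩
    0ℤ ℤ.+ x ℤ.* 0ℤ      ≡⟨ ℤ.+-identityˡ _ ⟩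
    x ℤ.* 0ℤ             ≡⟨ ℤ.*-zeroʳ x ⟩
    0ℤ                   ∎

  eval-cong : ∀ P Q → P ≈ₚ Q → eval P x ≡ eval Q x
  eval-cong P       []      eq = eval-≈[] P eq
  eval-cong []      (b ∷ Q) eq = sym (eval-≈[] (b ∷ Q) (sym ∘ eq))
  eval-cong (a ∷ P) (b ∷ Q) eq =
    cong₂ (λ a v → a ℤ.+ x ℤ.* v) (eq 0) (eval-cong P Q (eq ∘ suc))

  eval-+ₚ : ∀ P Q → eval (P +ₚ Q) x ≡ eval P x ℤ.+ eval Q x
  eval-+ₚ []      Q       = sym (ℤ.+-identityˡ _)
  eval-+ₚ (a ∷ P) []      = sym (ℤ.+-identityʳ _)
  eval-+ₚ (a ∷ P) (b ∷ Q) =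
    trans (cong (λ v → a ℤ.+ b ℤ.+ x ℤ.* v) (eval-+ₚ P Q)) (rearrange a b x _ _)
    where
    rearrange : ∀ a b x p q →
      a ℤ.+ b ℤ.+ x ℤ.* (p ℤ.+ q) ≡ a ℤ.+ x ℤ.* p ℤ.+ (b ℤ.+ x ℤ.* q)
    rearrange = solve-∀

  eval-·ₚ : ∀ c P → eval (c ·ₚ P) x ≡ c ℤ.* eval P x
  eval-·ₚ c []      = sym (ℤ.*-zeroʳ c)
  eval-·ₚ c (a ∷ P) = trans (cong (λ v → c ℤ.* a ℤ.+ x ℤ.* v) (eval-·ₚ c P)) (rearrange c a x _)
    where
    rearrange : ∀ c a x p → c ℤ.* a ℤ.+ x ℤ.* (c ℤ.* p) ≡ c ℤ.* (a ℤ.+ x ℤ.* p)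
    rearrange = solve-∀

  eval-*ₚ : ∀ P Q → eval (P *ₚ Q) x ≡ eval P x ℤ.* eval Q x
  eval-*ₚ []      Q = sym (ℤ.*-zeroˡ (eval Q x))
  eval-*ₚ (a ∷ P) Q = begin
    eval (a ·ₚ Q +ₚ (0ℤ ∷ (P *ₚ Q))) x
      ≡⟨ eval-+ₚ (a ·ₚ Q) _ ⟩
    eval (a ·ₚ Q) x ℤ.+ (0ℤ ℤ.+ x ℤ.* eval (P *ₚ Q) x)
      ≡⟨ cong₂ (λ u v → u ℤ.+ (0ℤ ℤ.+ x ℤ.* v)) (eval-·ₚ a Q) (eval-*ₚ P Q) ⟩
    a ℤ.* eval Q x ℤ.+ (0ℤ ℤ.+ x ℤ.* (eval P x ℤ.* eval Q x))
      ≡⟨ rearrange a x _ _ ⟩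
    (a ℤ.+ x ℤ.* eval P x) ℤ.* eval Q x ∎
    where
    rearrange : ∀ a x p q →
      a ℤ.* q ℤ.+ (0ℤ ℤ.+ x ℤ.* (p ℤ.* q)) ≡ (a ℤ.+ x ℤ.* p) ℤ.* q
    rearrange = solve-∀

  -- Evaluation is multiplicative. Used contrapositively: one failed divisibility between integer
  -- values refutes divisibility of polynomials.
  eval-∣ : ∀ {D P} → D ∣ₚ P → eval D x ℤ∣.∣ eval P x
  eval-∣ {D} {P} (Q , QD≈P) = divides ℤ.∣ eval Q x ∣ (begin
    ℤ.∣ eval P x ∣                ≡⟨ cong ℤ.∣_∣ (eval-cong (Q *ₚ D) P QD≈P) ⟨
    ℤ.∣ eval (Q *ₚ D) x ∣         ≡⟨ cong ℤ.∣_∣ (eval-*ₚ Q D) ⟩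
    ℤ.∣ eval Q x ℤ.* eval D x ∣   ≡⟨ ℤ.abs-* (eval Q x) (eval D x) ⟩
    ℤ.∣ eval Q x ∣ * ℤ.∣ eval D x ∣ ∎)

-- Primes and prime powers dividing an integer.

^-monoʳ-∣ : ∀ p {m n} → m ≤ n → p ^ m ∣ p ^ n
^-monoʳ-∣ p {m} {n} m≤n = subst (p ^ m ∣_) eq (m∣m*n (p ^ (n ∸ m)))
  where
  eq : p ^ m * p ^ (n ∸ m) ≡ p ^ n
  eq = trans (sym (^-distribˡ-+-* p m (n ∸ m))) (cong (p ^_) (m+[n∸m]≡n m≤n))

-- If k ≤ α, then p^k divides p^α and hence n. One failed divisibility thus leaves finitely many
-- exponents.
∤⇒exponent< : ∀ p k {n α} → ¬ (p ^ k ∣ n) → p ^ α ∣ n → α < k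
∤⇒exponent< p k pᵏ∤n pᵅ∣n = ≮⇒≥ λ k<1+α → pᵏ∤n (∣-trans (^-monoʳ-∣ p (s≤s⁻¹ k<1+α)) pᵅ∣n)

-- Exponent 0 would make 1 prime; otherwise p divides the prime q, so p is 1 or q.
primePower≡prime⇒base≡ : ∀ {p q} α → Prime p → Prime q → p ^ α ≡ q → p ≡ q
primePower≡prime⇒base≡         zero    pp pq refl = contradiction pq ¬prime[1]
primePower≡prime⇒base≡ {p} {q} (suc α) pp pq eq
  with prime⇒irreducible pq (subst (p ∣_) eq (m∣m*n (p ^ α)))
... | inj₁ refl = contradiction pp ¬prime[1]
... | inj₂ p≡q  = p≡q

-- By induction n = q · `product ps`. The new prime p divides one of these factors; dividing
-- `product ps` would make it a member of `ps`, so it divides q.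
productOfDistinctPrimes∣ : ∀ {n ps} → Unique ps → All Prime ps → All (_∣ n) ps → product ps ∣ n
productOfDistinctPrimes∣ {n} [] [] [] = 1∣ n
productOfDistinctPrimes∣ {ps = p ∷ ps} (p∉ps ∷ u) (pp ∷ pps) (p∣n ∷ ps∣n)
  with productOfDistinctPrimes∣ u pps ps∣n
... | divides q refl with euclidsLemma q (product ps) pp p∣n
...   | inj₁ p∣q  = subst (_∣ q * product ps) (*-comm (product ps) p)
                      (subst (product ps * p ∣_) (*-comm (product ps) q) (*-monoʳ-∣ (product ps) p∣q))
...   | inj₂ p∣ps =
  contradiction refl (All.lookup p∉ps (factorisationHasAllPrimeFactors pp p∣ps pps))

-- The witness and its cyclotomic divisors.

M : ℕ
M = 1260

-- The seven bits mark 0, 2, 3, 4, 6. Stretching each to a block of six yields the exponents 0, 12,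
-- 18, 24, 36, each shifted by 0 to 5; the padding is 1260 - 42 = 1218.
A : Subset M
A = Vec.concat (Vec.map (Vec.replicate 6)
      (inside ∷ outside ∷ inside ∷ inside ∷ inside ∷ outside ∷ inside ∷ []))
    ++ Vec.replicate 1218 outside

A-divisors : List ℕ
A-divisors = 2 ∷ 3 ∷ 5 ∷ 6 ∷ 10 ∷ 15 ∷ 30 ∷ 36 ∷ []

A-divisors-correct : All (λ s → Φ s ∣ₚ mask A) A-divisors
A-divisors-correct = exact 2 _ ∷ exact 3 _ ∷ exact 5 _ ∷ exact 6 _ ∷ exact 10 _
                   ∷ exact 15 _ ∷ exact 30 _ ∷ exact 36 _ ∷ []
  where
  exact : ∀ s → True ((mask A /ₚ Φ s) *ₚ Φ s ≈ₚ? mask A) → Φ s ∣ₚ mask A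
  exact s = exactDivision (Φ s) (mask A)

Φ∣A : ∀ {s} → s ∈ A-divisors → Φ s ∣ₚ mask A
Φ∣A = All.lookup A-divisors-correct

-- Φ₄(2) = 5 and Φ₉(2) = 73 do not divide A(2), and Φ₇(1) = 7 does not divide A(1) = 30.
Φ₄∤A : ¬ (Φ 4 ∣ₚ mask A)
Φ₄∤A Φ₄∣A = toWitnessFalse {a? = 5 ∣? ℤ.∣ eval (mask A) (+ 2) ∣} _ (eval-∣ (+ 2) Φ₄∣A)

Φ₉∤A : ¬ (Φ 9 ∣ₚ mask A)
Φ₉∤A Φ₉∣A = toWitnessFalse {a? = 73 ∣? ℤ.∣ eval (mask A) (+ 2) ∣} _ (eval-∣ (+ 2) Φ₉∣A)

Φ₇∤A : ¬ (Φ 7 ∣ₚ mask A)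
Φ₇∤A Φ₇∣A = toWitnessFalse {a? = 7 ∣? 30} _ (eval-∣ 1ℤ Φ₇∣A)

-- Divisors of 30, 36 and `M`.

∣30⇒∈A-divisors : ∀ {n} → n ∣ 30 → n ≢ 1 → n ∈ A-divisors
-- A divisor of 30 is below 31, so the search is finite.
∣30⇒∈A-divisors n∣30 = toWitness {a? = allUpTo? dec? 31} _ (s≤s (∣⇒≤ n∣30)) n∣30
  where
  dec? : ∀ n → Dec (n ∣ 30 → n ≢ 1 → n ∈ A-divisors)
  dec? n = n ∣? 30 →-dec ¬? (n ≟ 1) →-dec n ∈? A-divisors

prime∣M⇒∈ : ∀ {p} → Prime p → p ∣ M → p ∈ 2 ∷ 3 ∷ 5 ∷ 7 ∷ []
-- 1260 is the product of `factorsPrime`, taken with multiplicity; `within` then forgets the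
-- repetitions.
prime∣M⇒∈ pp p∣M = All.lookup within (factorisationHasAllPrimeFactors pp p∣M factorsPrime)
  where
  factorsPrime : All Prime (2 ∷ 2 ∷ 3 ∷ 3 ∷ 5 ∷ 7 ∷ [])
  factorsPrime = from-yes (All.all? prime? (2 ∷ 2 ∷ 3 ∷ 3 ∷ 5 ∷ 7 ∷ []))
  within : All (_∈ 2 ∷ 3 ∷ 5 ∷ 7 ∷ []) (2 ∷ 2 ∷ 3 ∷ 3 ∷ 5 ∷ 7 ∷ [])
  within = from-yes (All.all? (_∈? 2 ∷ 3 ∷ 5 ∷ 7 ∷ []) (2 ∷ 2 ∷ 3 ∷ 3 ∷ 5 ∷ 7 ∷ []))

prime∣36⇒∈ : ∀ {p} → Prime p → p ∣ 36 → p ∈ 2 ∷ 3 ∷ []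
prime∣36⇒∈ pp p∣36 with prime∣M⇒∈ pp (∣-trans p∣36 (divides 35 refl))
... | here refl                         = here refl
... | there (here refl)                 = there (here refl)
... | there (there (here refl))         = contradiction p∣36 (from-no (5 ∣? 36))
... | there (there (there (here refl))) = contradiction p∣36 (from-no (7 ∣? 36))

-- None of 8, 27, 25, 49 divides 1260, which bounds the exponent of each of the four primes.
primePower∣M⇒∈ : ∀ {p} α → Prime p → 1 ≤ α → p ^ α ∣ M →
  p ^ α ∈ 2 ∷ 4 ∷ 3 ∷ 9 ∷ 5 ∷ 7 ∷ []
primePower∣M⇒∈ {p} α@(suc β) pp 1≤α pᵅ∣M with prime∣M⇒∈ pp (∣-trans (m∣m*n (p ^ β)) pᵅ∣M)
... | here refl = bounded α 1≤α (∤⇒exponent< 2 3 (from-no (8 ∣? M)) pᵅ∣M)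
  where
  bounded : ∀ α → 1 ≤ α → α < 3 → 2 ^ α ∈ 2 ∷ 4 ∷ 3 ∷ 9 ∷ 5 ∷ 7 ∷ []
  bounded 1 _ _ = here refl
  bounded 2 _ _ = there (here refl)
  bounded (suc (suc (suc _))) _ (s≤s (s≤s (s≤s ())))
... | there (here refl) = bounded α 1≤α (∤⇒exponent< 3 3 (from-no (27 ∣? M)) pᵅ∣M)
  where
  bounded : ∀ α → 1 ≤ α → α < 3 → 3 ^ α ∈ 2 ∷ 4 ∷ 3 ∷ 9 ∷ 5 ∷ 7 ∷ []
  bounded 1 _ _ = there (there (here refl))
  bounded 2 _ _ = there (there (there (here refl)))
  bounded (suc (suc (suc _))) _ (s≤s (s≤s (s≤s ())))
... | there (there (here refl)) = bounded α 1≤α (∤⇒exponent< 5 2 (from-no (25 ∣? M)) pᵅ∣M)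
  where
  bounded : ∀ α → 1 ≤ α → α < 2 → 5 ^ α ∈ 2 ∷ 4 ∷ 3 ∷ 9 ∷ 5 ∷ 7 ∷ []
  bounded 1 _ _ = there (there (there (there (here refl))))
  bounded (suc (suc _)) _ (s≤s (s≤s ()))
... | there (there (there (here refl))) = bounded α 1≤α (∤⇒exponent< 7 2 (from-no (49 ∣? M)) pᵅ∣M)
  where
  bounded : ∀ α → 1 ≤ α → α < 2 → 7 ^ α ∈ 2 ∷ 4 ∷ 3 ∷ 9 ∷ 5 ∷ 7 ∷ []
  bounded 1 _ _ = there (there (there (there (there (here refl)))))
  bounded (suc (suc _)) _ (s≤s (s≤s ()))

-- The set of prime power divisors, (T1) and (T2).

S : List ℕ
S = 2 ∷ 3 ∷ 5 ∷ []

S-prime : All Prime S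
S-prime = from-yes (All.all? prime? S)

S⊆A-divisors : All (_∈ A-divisors) S
S⊆A-divisors = from-yes (All.all? (_∈? A-divisors) S)

S∣30 : All (_∣ 30) S
S∣30 = from-yes (All.all? (_∣? 30) S)

S∣M : All (_∣ M) S
S∣M = All.map (λ s∣30 → ∣-trans s∣30 (divides 42 refl)) S∣30

∈S*⇒∈S : ∀ {s} → s ∈S* A → s ∈ S
∈S*⇒∈S ((p , α , pp , 1≤α , refl) , s∣M , Φₛ∣A) = select (primePower∣M⇒∈ α pp 1≤α s∣M) Φₛ∣A
  where
  -- The power p^α is generalised to a variable `s`, so that `refl` can identify it with each
  -- candidate.
  select : ∀ {s} → s ∈ 2 ∷ 4 ∷ 3 ∷ 9 ∷ 5 ∷ 7 ∷ [] → Φ s ∣ₚ mask A → s ∈ S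
  select (here refl)                                         _    = here refl
  select (there (here refl))                                 Φ₄∣A = contradiction Φ₄∣A Φ₄∤A
  select (there (there (here refl)))                         _    = there (here refl)
  select (there (there (there (here refl))))                 Φ₉∣A = contradiction Φ₉∣A Φ₉∤A
  select (there (there (there (there (here refl)))))         _    = there (there (here refl))
  select (there (there (there (there (there (here refl)))))) Φ₇∣A = contradiction Φ₇∣A Φ₇∤A

∈S⇒∈S* : ∀ {s} → s ∈ S → s ∈S* A
∈S⇒∈S* {s} s∈S =
  (s , 1 , All.lookup S-prime s∈S , s≤s z≤n , sym (*-identityʳ s)) ,
  All.lookup S∣M s∈S , Φ∣A (All.lookup S⊆A-divisors s∈S)

-- Φ_p(1) = p for a prime p, so both sides compute to 2 · 3 · 5 = 30.
A-T1 : T1 A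
A-T1 = S , from-yes (unique? S) , (λ s → mk⇔ ∈S⇒∈S* ∈S*⇒∈S) , refl

-- Every element of S_A^* is prime, so all exponents are 1 and the product in (T2) is a divisor of
-- 30 other than 1; each such divisor indexes a cyclotomic factor of A(X).
A-T2 : T2 A
A-T2 pαs pαs≢[] inS* unique =
  Φ∣A (∣30⇒∈A-divisors (subst (_∣ 30) (sym Πpᵅ≡Πp) Πp∣30) (Πp≢1 pαs pαs≢[] inS* ∘ trans (sym Πpᵅ≡Πp)))
  where
  pᵅ∈S : ∀ p α → Prime p × p ^ α ∈S* A → p ^ α ∈ S × p ≡ p ^ α
  pᵅ∈S p α (pp , h) with ∈S*⇒∈S h
  ... | q∈S = q∈S , primePower≡prime⇒base≡ α pp (All.lookup S-prime q∈S) refl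

  Πpᵅ≡Πp : product (map (uncurry _^_) pαs) ≡ product (map proj₁ pαs)
  Πpᵅ≡Πp = cong product (map-cong-local (All.map (λ {(p , α)} → sym ∘ proj₂ ∘ pᵅ∈S p α) inS*))

  Πp∣30 : product (map proj₁ pαs) ∣ 30
  Πp∣30 = productOfDistinctPrimes∣ unique
    (All.map⁺ (All.map proj₁ inS*))
    (All.map⁺ (All.map (λ {(p , α)} h → let q∈S , p≡q = pᵅ∈S p α h in
                               subst (_∣ 30) (sym p≡q) (All.lookup S∣30 q∈S)) inS*))

  -- A nonempty product equal to 1 would force its first prime to be 1.
  Πp≢1 : ∀ pαs → pαs ≢ [] → All (λ (p , α) → Prime p × p ^ α ∈S* A) pαs →
    product (map proj₁ pαs) ≢ 1
  Πp≢1 []              ≢[] _              _  = ≢[] refl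
  Πp≢1 ((p , _) ∷ pαs) _   ((pp , _) ∷ _) eq = ¬prime[1] (subst Prime (m*n≡1⇒m≡1 p _ eq) pp)

-- The primes of `M` and the unsupported divisor.

M-primes : HasDistinctPrimeDivisors 4 M
M-primes = primes , refl , from-yes (unique? primes) ,
  λ p → mk⇔ (λ p∈ → All.lookup areDivisors p∈) (λ (pp , p∣M) → prime∣M⇒∈ pp p∣M)
  where
  primes : List ℕ
  primes = 2 ∷ 3 ∷ 5 ∷ 7 ∷ []
  areDivisors : All (λ p → Prime p × p ∣ M) primes
  areDivisors = from-yes (All.all? (λ p → prime? p ×-dec p ∣? M) primes)

Φ₃₆-unsupported : Unsupported A 36
Φ₃₆-unsupported = record
  { s∣M        = divides 35 refl
  ; s≢1        = λ ()
  ; divisor    = Φ∣A (from-yes (36 ∈? A-divisors))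
  ; primes     = λ p pp p∣36 → All.lookup 2,3∣∣A∣ (prime∣36⇒∈ pp p∣36)
  ; noPrimePow = noPrimePow
  }
  where
  2,3∣∣A∣ : All (_∣ ∣ A ∣) (2 ∷ 3 ∷ [])
  2,3∣∣A∣ = divides 15 refl ∷ divides 10 refl ∷ []

  noPrimePow : ∀ p α → Prime p → p ∣ 36 → p ^ α ∣ 36 → ¬ (p ^ suc α ∣ 36) → ¬ (Φ (p ^ α) ∣ₚ mask A)
  noPrimePow p α pp p∣36 pᵅ∣36 pᵅ⁺¹∤36 with prime∣36⇒∈ pp p∣36
  ... | here refl         = exponent α (∤⇒exponent< 2 3 (from-no (8 ∣? 36)) pᵅ∣36) pᵅ⁺¹∤36
    where
    -- Only α = 2 is exact, as 2 and 4 divide 36 but 8 does not; the relevant power is thus 4.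
    exponent : ∀ α → α < 3 → ¬ (2 ^ suc α ∣ 36) → ¬ (Φ (2 ^ α) ∣ₚ mask A)
    exponent 0 _ ∤36 = contradiction (divides 18 refl) ∤36
    exponent 1 _ ∤36 = contradiction (divides 9 refl) ∤36
    exponent 2 _ _   = Φ₄∤A
    exponent (suc (suc (suc _))) (s≤s (s≤s (s≤s ())))
  ... | there (here refl) = exponent α (∤⇒exponent< 3 3 (from-no (27 ∣? 36)) pᵅ∣36) pᵅ⁺¹∤36
    where
    -- Likewise 3 and 9 divide 36 but 27 does not, leaving 9.
    exponent : ∀ α → α < 3 → ¬ (3 ^ suc α ∣ 36) → ¬ (Φ (3 ^ α) ∣ₚ mask A)
    exponent 0 _ ∤36 = contradiction (divides 12 refl) ∤36
    exponent 1 _ ∤36 = contradiction (divides 4 refl) ∤36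
    exponent 2 _ _   = Φ₉∤A
    exponent (suc (suc (suc _))) (s≤s (s≤s (s≤s ())))

theorem1p11 : Σ[ M ∈ ℕ ] Σ[ A ∈ Subset M ]
    (Nonempty A × T1 A × T2 A × HasDistinctPrimeDivisors 4 M ×
    (Σ[ s ∈ ℕ ] Unsupported A s))
theorem1p11 = M , A , (zero , Vec.here) , A-T1 , A-T2 , M-primes , 36 , Φ₃₆-unsupported
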